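{- Let $n'\geqslant 1$ be an integer and $n=3n'$. Then for every integer $r\in\{n-1-p_{\max}(n'),\ldots,n-1\}$ there exists an $r$-regular maximal $(2,3)$-antichain on $n$ points.
   Context: Let $[n]=\{1,2,\ldots,n\}$. A maximal $(2,3)$-antichain on $n$ points is a family $\mathcal{A}=\mathcal{A}_2\cup\mathcal{A}_3$ with $\mathcal{A}_2\subseteq\binom{[n]}{2}$ (2-element subsets) and $\mathcal{A}_3\subseteq\binom{[n]}{3}$ (3-element subsets) such that (1) no member of $\mathcal{A}$ is a subset of another member of $\mathcal{A}$, and (2) for every $X\in 2^{[n]}\setminus\mathcal{A}$ there is an $A\in\mathcal{A}$ with $X\subseteq A$ or $A\subseteq X$. It is $r$-regular if every element of $[n]$ is contained in exactly $r$ members of $\mathcal{A}$. For a positive integer $n'$, $p_{\max}(n')$ denotes the maximal $p$ for which there exist an abelian group $\Gamma$ (written additively) of order $|\Gamma|=n'$ and sequences $A=(a_1,\ldots,a_p)$ and $B=(b_1,\ldots,b_p)$ of elements of $\Gamma$ such that: (i) $a_i\neq a_j$ and $b_i\neq b_j$ for $i\neq j$; (ii) the sequence $C=(b_1-a_1,\ldots,b_p-a_p)$ has pairwise distinct entries, i.e. $b_i-a_i\neq b_j-a_j$ for $i\neq j$; (iii) $b_j-a_i$ is not an entry of $C$ for all $i\neq j$. -}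

module Defs where

open import Algebra.Bundles using (AbelianGroup)
open import Data.Fin.Base using (Fin; zero; suc; toℕ; fromℕ<)
open import Data.Fin.Properties
  using (_≟_; any?; all?; injective⇒≤; toℕ-fromℕ<; toℕ-injective; toℕ<n)
open import Data.Fin.Subset using (Subset; ∣_∣; _⊆_; _⊈_) renaming (_∈_ to _∈ₛ_)
open import Data.Fin.Subset.Properties using () renaming (_∈?_ to _∈ₛ?_)
open import Data.List.Base using (List; length; filter)
open import Data.List.Membership.Propositional using (_∈_; _∉_)
open import Data.List.Relation.Unary.Unique.Propositional using (Unique)
open import Data.Nat.Base using (ℕ; zero; suc; _+_; _∸_; _≤_; _<_; z<s; NonZero)
open import Data.Nat.DivMod
  using (_%_; m%n<n; m<n⇒m%n≡m; %-distribˡ-+; n%n≡0; m%n%n≡m%n)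
open import Data.Nat.Properties
  using (+-comm; +-assoc; m∸n+n≡m; <⇒≤; ≤∧≢⇒<; m<1+n⇒m≤n)
open import Data.Product.Base using (Σ-syntax; ∃; ∃-syntax; ∃₂; _×_; _,_; proj₁; proj₂)
open import Data.Sum.Base using (_⊎_)
open import Data.Vec.Base using (Vec; []; _∷_; lookup; tabulate)
open import Data.Vec.Properties using (lookup∘tabulate)
open import Function.Base using (_∘_)
open import Function.Bundles using (Inverse)
open import Function.Construct.Identity using () renaming (inverse to idInverse)
open import Level using (0ℓ)
open import Relation.Binary.PropositionalEquality
  using (_≡_; _≢_; refl; sym; trans; cong; cong₂; setoid; isEquivalence; module ≡-Reasoning)
open import Relation.Nullary using (¬_; Dec; yes; no; contradiction)
open import Relation.Nullary.Decidable using (map′; _×-dec_; _→-dec_; ¬?)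
open import Relation.Unary using (Pred; Decidable)

-- The ground set is Fin n, and a family of subsets is a list in which no
-- subset is repeated.

record IsMaximal23Antichain {n : ℕ} (𝒜 : List (Subset n)) : Set where
  field
    unique    : Unique 𝒜
    sizes     : ∀ {A} → A ∈ 𝒜 → ∣ A ∣ ≡ 2 ⊎ ∣ A ∣ ≡ 3
    antichain : ∀ {A B} → A ∈ 𝒜 → B ∈ 𝒜 → A ≢ B → A ⊈ B
    maximal   : ∀ X → X ∉ 𝒜 → ∃[ A ] (A ∈ 𝒜 × (X ⊆ A ⊎ A ⊆ X))

degree : ∀ {n} → List (Subset n) → Fin n → ℕ
degree 𝒜 x = length (filter (x ∈ₛ?_) 𝒜)

IsRegular : ∀ {n} → ℕ → List (Subset n) → Set
IsRegular r 𝒜 = ∀ x → degree 𝒜 x ≡ r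

HasOrder : AbelianGroup 0ℓ 0ℓ → ℕ → Set
HasOrder Γ m = Inverse (AbelianGroup.setoid Γ) (setoid (Fin m))

-- The stdlib writes the group operation of Γ as _∙_, and x - y for x ∙ y ⁻¹.

record IsAdmissible (Γ : AbelianGroup 0ℓ 0ℓ) {p : ℕ}
                    (a b : Fin p → AbelianGroup.Carrier Γ) : Set where
  open AbelianGroup Γ
  c : Fin p → Carrier
  c i = b i - a i
  field
    a-distinct : ∀ i j → i ≢ j → a i ≉ a j
    b-distinct : ∀ i j → i ≢ j → b i ≉ b j
    c-distinct : ∀ i j → i ≢ j → c i ≉ c j
    c-avoids   : ∀ i j → i ≢ j → ¬ (∃[ k ] b j - a i ≈ c k)

-- Restricting to level 0 loses nothing: every group of order m is isomorphic
-- to one with carrier Fin m.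

Attained : ℕ → ℕ → Set₁
Attained m p = Σ[ Γ ∈ AbelianGroup 0ℓ 0ℓ ] HasOrder Γ m ×
               ∃₂ λ (a b : Fin p → AbelianGroup.Carrier Γ) → IsAdmissible Γ a b

record IsPMax (m p : ℕ) : Set₁ where
  field
    attained : Attained m p
    maximum  : ∀ q → Attained m q → q ≤ p

-- The maximum exists because it suffices to search the finitely many group
-- structures on Fin m, each given by its operation tables.

private

  Searchable : Set → Set₁
  Searchable A = {P : Pred A 0ℓ} → Decidable P → Dec (∃ P)

  searchVec : ∀ {A} → Searchable A → ∀ n → Searchable (Vec A n)
  searchVec s zero    P? = map′ ([] ,_) (λ { ([] , px) → px }) (P? [])
  searchVec s (suc n) P? =
    map′ (λ { (x , xs , px) → x ∷ xs , px }) (λ { (x ∷ xs , px) → x , xs , px })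
         (s λ x → searchVec s n λ xs → P? (x ∷ xs))

  record Laws {m : ℕ} (_∙_ : Fin m → Fin m → Fin m) (e : Fin m) (inv : Fin m → Fin m) : Set where
    field
      assoc : ∀ x y z → (x ∙ y) ∙ z ≡ x ∙ (y ∙ z)
      comm  : ∀ x y → x ∙ y ≡ y ∙ x
      idˡ   : ∀ x → e ∙ x ≡ x
      invˡ  : ∀ x → inv x ∙ x ≡ e

  finGroup : ∀ {m} {_∙_ : Fin m → Fin m → Fin m} {e inv} → Laws _∙_ e inv → AbelianGroup 0ℓ 0ℓ
  finGroup {m} {_∙_} {e} {inv} laws = record
    { Carrier = Fin m ; _≈_ = _≡_ ; _∙_ = _∙_ ; ε = e ; _⁻¹ = inv
    ; isAbelianGroup = record
      { isGroup = record
        { isMonoid = record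
          { isSemigroup = record
            { isMagma = record { isEquivalence = isEquivalence ; ∙-cong = cong₂ _∙_ }
            ; assoc = assoc }
          ; identity = idˡ , λ x → trans (comm x e) (idˡ x) }
        ; inverse = invˡ , λ x → trans (comm x (inv x)) (invˡ x)
        ; ⁻¹-cong = cong inv }
      ; comm = comm } }
    where open Laws laws

  laws? : ∀ {m} (_∙_ : Fin m → Fin m → Fin m) e inv → Dec (Laws _∙_ e inv)
  laws? _∙_ e inv =
    map′ (λ { (p , q , r , s) → record { assoc = p ; comm = q ; idˡ = r ; invˡ = s } })
         (λ L → let open Laws L in assoc , comm , idˡ , invˡ)
         ( (all? λ x → all? λ y → all? λ z → ((x ∙ y) ∙ z) ≟ (x ∙ (y ∙ z)))
      ×-dec (all? λ x → all? λ y → (x ∙ y) ≟ (y ∙ x))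
      ×-dec (all? λ x → (e ∙ x) ≟ x)
      ×-dec (all? λ x → (inv x ∙ x) ≟ e))

  admissible? : ∀ {m} {_∙_ : Fin m → Fin m → Fin m} {e inv} (L : Laws _∙_ e inv)
                {p} (a b : Fin p → Fin m) → Dec (IsAdmissible (finGroup L) a b)
  admissible? {_∙_ = _∙_} {inv = inv} L a b =
    map′ (λ { (p , q , r , s) → record
              { a-distinct = p ; b-distinct = q ; c-distinct = r ; c-avoids = s } })
         (λ A → let open IsAdmissible A in a-distinct , b-distinct , c-distinct , c-avoids)
         ( (all? λ i → all? λ j → ¬? (i ≟ j) →-dec ¬? (a i ≟ a j))
      ×-dec (all? λ i → all? λ j → ¬? (i ≟ j) →-dec ¬? (b i ≟ b j))
      ×-dec (all? λ i → all? λ j → ¬? (i ≟ j) →-dec ¬? ((b i ∙ inv (a i)) ≟ (b j ∙ inv (a j))))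
      ×-dec (all? λ i → all? λ j → ¬? (i ≟ j) →-dec
             ¬? (any? λ k → (b j ∙ inv (a i)) ≟ (b k ∙ inv (a k)))))

  op : ∀ {m} → Vec (Vec (Fin m) m) m → Fin m → Fin m → Fin m
  op t x y = lookup (lookup t x) y

  Tables : ℕ → ℕ → Set
  Tables m p = ∃[ t ] ∃[ e ] ∃[ v ] Σ[ L ∈ Laws {m} (op t) e (lookup v) ]
               ∃[ a ] ∃[ b ] IsAdmissible (finGroup L) {p} (lookup a) (lookup b)

  tables? : ∀ m p → Dec (Tables m p)
  tables? m p =
    searchVec (searchVec any? m) m λ t → any? λ e → searchVec any? m λ v → go t e v
    where
    go : ∀ t e v → Dec (Σ[ L ∈ Laws {m} (op t) e (lookup v) ]
           ∃[ a ] ∃[ b ] IsAdmissible (finGroup L) {p} (lookup a) (lookup b))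
    go t e v with laws? (op t) e (lookup v)
    ... | no ¬L = no (¬L ∘ proj₁)
    ... | yes L =
      map′ (L ,_)
           (λ { (_ , a , b , A) → a , b , record { IsAdmissible A } })
           (searchVec any? p λ a → searchVec any? p λ b →
             admissible? L (lookup a) (lookup b))

  tables⇒attained : ∀ {m p} → Tables m p → Attained m p
  tables⇒attained (_ , _ , _ , L , a , b , A) =
    finGroup L , idInverse _ , lookup a , lookup b , A

  attained⇒tables : ∀ {m p} → Attained m p → Tables m p
  attained⇒tables {m} {p} (Γ , ord , a , b , A) =
    t , to ε , v , L , tabulate (to ∘ a) , tabulate (to ∘ b) , record
      { a-distinct = λ i j i≢j eq → a-distinct i j i≢j (reflect (subst-a i j eq))
      ; b-distinct = λ i j i≢j eq → b-distinct i j i≢j (reflect (subst-b i j eq))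
      ; c-distinct = λ i j i≢j eq → c-distinct i j i≢j
          (reflect (trans (sym (diff i i)) (trans eq (diff j j))))
      ; c-avoids   = λ { i j i≢j (k , eq) → c-avoids i j i≢j
          (k , reflect (trans (sym (diff j i)) (trans eq (diff k k)))) }
      }
    where
    open AbelianGroup Γ renaming (refl to ≈-refl; sym to ≈-sym; trans to ≈-trans)
      hiding (setoid; isEquivalence)
    open Inverse ord using (to; from; to-cong; strictlyInverseˡ; strictlyInverseʳ)
    open IsAdmissible A hiding (c)

    reflect : ∀ {x y} → to x ≡ to y → x ≈ y
    reflect {x} {y} eq = ≈-trans (≈-sym (strictlyInverseʳ x))
      (≈-trans (Inverse.from-cong ord eq) (strictlyInverseʳ y))

    t = tabulate λ x → tabulate λ y → to (from x ∙ from y)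
    v = tabulate λ x → to (from x ⁻¹)

    t-op : ∀ x y → op t x y ≡ to (from x ∙ from y)
    t-op x y = trans
      (cong (λ w → lookup w y)
        (lookup∘tabulate (λ x → tabulate λ y → to (from x ∙ from y)) x))
      (lookup∘tabulate (λ y → to (from x ∙ from y)) y)

    v-inv : ∀ x → lookup v x ≡ to (from x ⁻¹)
    v-inv = lookup∘tabulate _

    L : Laws (op t) (to ε) (lookup v)
    L = record
      { assoc = λ x y z → begin
          op t (op t x y) z                            ≡⟨ cong (λ w → op t w z) (t-op x y) ⟩
          op t (to (from x ∙ from y)) z                ≡⟨ t-op _ z ⟩
          to (from (to (from x ∙ from y)) ∙ from z)    ≡⟨ to-cong (∙-congʳ (strictlyInverseʳ _)) ⟩
          to ((from x ∙ from y) ∙ from z)              ≡⟨ to-cong (assoc _ _ _) ⟩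
          to (from x ∙ (from y ∙ from z))              ≡⟨ to-cong (∙-congˡ (strictlyInverseʳ _)) ⟨
          to (from x ∙ from (to (from y ∙ from z)))    ≡⟨ t-op x _ ⟨
          op t x (to (from y ∙ from z))                ≡⟨ cong (op t x) (t-op y z) ⟨
          op t x (op t y z)                            ∎
      ; comm = λ x y → trans (t-op x y) (trans (to-cong (comm _ _)) (sym (t-op y x)))
      ; idˡ = λ x → trans (t-op _ x) (trans
          (to-cong (≈-trans (∙-congʳ (strictlyInverseʳ ε)) (identityˡ _)))
          (strictlyInverseˡ x))
      ; invˡ = λ x → trans (cong (λ w → op t w x) (v-inv x)) (trans (t-op _ x)
          (to-cong (≈-trans (∙-congʳ (strictlyInverseʳ _)) (inverseˡ _))))
      }
      where open ≡-Reasoning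

    a≡ : ∀ i → lookup (tabulate (to ∘ a)) i ≡ to (a i)
    a≡ = lookup∘tabulate _
    b≡ : ∀ i → lookup (tabulate (to ∘ b)) i ≡ to (b i)
    b≡ = lookup∘tabulate _

    subst-a : ∀ i j → lookup (tabulate (to ∘ a)) i ≡ lookup (tabulate (to ∘ a)) j → to (a i) ≡ to (a j)
    subst-a i j eq = trans (sym (a≡ i)) (trans eq (a≡ j))
    subst-b : ∀ i j → lookup (tabulate (to ∘ b)) i ≡ lookup (tabulate (to ∘ b)) j → to (b i) ≡ to (b j)
    subst-b i j eq = trans (sym (b≡ i)) (trans eq (b≡ j))

    diff : ∀ j i → op t (lookup (tabulate (to ∘ b)) j) (lookup v (lookup (tabulate (to ∘ a)) i))
                   ≡ to (b j - a i)
    diff j i = trans (cong₂ (op t) (b≡ j) (trans (cong (lookup v) (a≡ i)) (v-inv (to (a i)))))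
      (trans (t-op _ _) (to-cong (∙-cong (strictlyInverseʳ _)
        (≈-trans (strictlyInverseʳ _) (⁻¹-cong (strictlyInverseʳ _))))))

  attained⇒≤ : ∀ {m p} → Attained m p → p ≤ m
  attained⇒≤ (Γ , ord , a , _ , A) = injective⇒≤ {f = to ∘ a} inj
    where
    open AbelianGroup Γ using () renaming (sym to ≈-sym; trans to ≈-trans)
    open Inverse ord using (to; from-cong; strictlyInverseʳ)
    inj : ∀ {i j} → to (a i) ≡ to (a j) → i ≡ j
    inj {i} {j} eq with i ≟ j
    ... | yes i≡j = i≡j
    ... | no  i≢j = contradiction
      (≈-trans (≈-sym (strictlyInverseʳ (a i))) (≈-trans (from-cong eq) (strictlyInverseʳ (a j))))
      (IsAdmissible.a-distinct A i j i≢j)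

  -- Some p, namely 0, is attained, because a group of order m exists.
  module Cyclic (m : ℕ) .{{_ : NonZero m}} where
    open ≡-Reasoning

    red : ℕ → Fin m
    red k = fromℕ< (m%n<n k m)

    toℕ-red : ∀ k → toℕ (red k) ≡ k % m
    toℕ-red k = toℕ-fromℕ< (m%n<n k m)

    red-cong : ∀ {k l} → k % m ≡ l % m → red k ≡ red l
    red-cong {k} {l} eq = toℕ-injective (trans (toℕ-red k) (trans eq (sym (toℕ-red l))))

    red-toℕ : ∀ x → red (toℕ x) ≡ x
    red-toℕ x = toℕ-injective (trans (toℕ-red (toℕ x)) (m<n⇒m%n≡m (toℕ<n x)))

    %-+ˡ : ∀ k l → (k % m + l) % m ≡ (k + l) % m
    %-+ˡ k l = begin
      (k % m + l) % m          ≡⟨ %-distribˡ-+ (k % m) l m ⟩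
      (k % m % m + l % m) % m  ≡⟨ cong (λ w → (w + l % m) % m) (m%n%n≡m%n k m) ⟩
      (k % m + l % m) % m      ≡⟨ %-distribˡ-+ k l m ⟨
      (k + l) % m              ∎

    red-+ˡ : ∀ k l → red (toℕ (red k) + l) ≡ red (k + l)
    red-+ˡ k l = red-cong (trans (cong (λ w → (w + l) % m) (toℕ-red k)) (%-+ˡ k l))

    red-+ʳ : ∀ k l → red (k + toℕ (red l)) ≡ red (k + l)
    red-+ʳ k l = begin
      red (k + toℕ (red l))  ≡⟨ cong red (+-comm k _) ⟩
      red (toℕ (red l) + k)  ≡⟨ red-+ˡ l k ⟩
      red (l + k)            ≡⟨ cong red (+-comm l k) ⟩
      red (k + l)            ∎

    laws : Laws (λ x y → red (toℕ x + toℕ y)) (red 0) (λ x → red (m ∸ toℕ x))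
    laws = record
      { assoc = λ x y z → trans (red-+ˡ (toℕ x + toℕ y) (toℕ z))
          (trans (cong red (+-assoc (toℕ x) (toℕ y) (toℕ z)))
                 (sym (red-+ʳ (toℕ x) (toℕ y + toℕ z))))
      ; comm = λ x y → cong red (+-comm (toℕ x) (toℕ y))
      ; idˡ  = λ x → trans (red-+ˡ 0 (toℕ x)) (red-toℕ x)
      ; invˡ = λ x → trans (red-+ˡ (m ∸ toℕ x) (toℕ x))
          (trans (cong red (m∸n+n≡m (<⇒≤ (toℕ<n x))))
                 (red-cong (trans (n%n≡0 m) (sym (m<n⇒m%n≡m (0<m x))))))
      }
      where
      0<m : Fin m → 0 < m
      0<m zero    = z<s
      0<m (suc _) = z<s

  attained-0 : ∀ m → .{{_ : NonZero m}} → Attained m 0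
  attained-0 m = finGroup (Cyclic.laws m) , idInverse _ , (λ ()) , (λ ()) , record
    { a-distinct = λ () ; b-distinct = λ () ; c-distinct = λ () ; c-avoids = λ () }

  greatest : ∀ {P : ℕ → Set₁} → (∀ k → Dec (P k)) → P 0 → ∀ bound →
             ∃[ p ] (P p × (∀ q → q ≤ bound → P q → q ≤ p))
  greatest P? P0 zero = 0 , P0 , λ q q≤0 _ → q≤0
  greatest P? P0 (suc n) with P? (suc n) | greatest P? P0 n
  ... | yes Pn | _ = suc n , Pn , λ q q≤n _ → q≤n
  ... | no ¬Pn | p , Pp , max = p , Pp , λ q q≤1+n Pq →
    max q (m<1+n⇒m≤n (≤∧≢⇒< q≤1+n λ { refl → ¬Pn Pq })) Pq

abstract
  p-max-exists : ∀ m → .{{_ : NonZero m}} → ∃[ p ] IsPMax m p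
  p-max-exists m
    with p , att , max ← greatest
           (λ p → map′ tables⇒attained attained⇒tables (tables? m p)) (attained-0 m) m
    = p , record { attained = att ; maximum = λ q Aq → max q (attained⇒≤ Aq) Aq }

p-max : ∀ m → .{{_ : NonZero m}} → ℕ
p-max m = proj₁ (p-max-exists m)

p-max-isPMax : ∀ m → .{{_ : NonZero m}} → IsPMax m (p-max m)
p-max-isPMax m = proj₂ (p-max-exists m)

-- Hence 3 * m ∸ 1 ∸ p-max m is never truncated.
p-max≤ : ∀ m → .{{_ : NonZero m}} → p-max m ≤ m
p-max≤ m = attained⇒≤ (IsPMax.attained (p-max-isPMax m))

{-# OPTIONS --safe #-}

-- Take a graph G on the vertices in which every edge lies in a triangle.  The
-- non-edges and the triangles of G form a maximal (2,3)-antichain, and a vertex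
-- in d edges and t triangles of G has degree n - 1 - d + t.  For G take the
-- tripartite graph on three copies of Γ whose triangles
-- {(0 , x) , (1 , x + a_i) , (2 , x + b_i)}, for x in Γ and i among s indices,
-- use up its edges: then d = 2s, and the conditions on a and b say precisely
-- that there are no further triangles, so that t = s.

module Submission where

open import Defs
open import Algebra.Bundles using (AbelianGroup)
import Algebra.Properties.AbelianGroup as AbelianGroupProperties
import Algebra.Properties.Group as GroupProperties
open import Data.Bool.Base using (true; false)
import Data.Bool.Properties as Bool
open import Data.Nat.Base using (ℕ; zero; suc; _+_; _*_; _∸_; _≤_; s≤s; NonZero; >-nonZero⁻¹)
open import Data.Nat.Properties as ℕ
  using (+-cancelʳ-≡; +-monoʳ-≤; m+[n∸m]≡n; m≤n+m∸n; m≤n+o⇒m∸n≤o; m*n≢0)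
open import Data.List.Base using (List; []; _∷_; _++_; length; map; filter; allFin; cartesianProductWith)
open import Data.List.Membership.Propositional using (_∈_)
open import Data.List.Membership.Propositional.Properties
  using (∈-filter⁺; ∈-filter⁻; ∈-map⁺; ∈-map⁻; ∈-allFin; ∈-++⁺ˡ; ∈-++⁺ʳ; ∈-cartesianProductWith⁺)
open import Data.List.Membership.Propositional.Properties.WithK using (unique∧set⇒bag)
open import Data.List.Properties using (length-map; length-++; length-tabulate)
open import Data.List.Relation.Binary.BagAndSetEquality using (∼bag⇒↭)
open import Data.List.Relation.Binary.Permutation.Propositional.Properties using (↭-length)
open import Data.List.Relation.Unary.All as All using ([]; _∷_)
open import Data.List.Relation.Unary.AllPairs using ([]; _∷_)
open import Data.List.Relation.Unary.Any using (here; there)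
open import Data.List.Relation.Unary.Unique.Propositional using (Unique)
import Data.List.Relation.Unary.Unique.Propositional.Properties as Unique
open import Data.Fin.Base using (Fin; zero; suc; combine; remQuot; inject≤)
open import Data.Fin.Properties
  using (_≟_; any?; remQuot-combine; combine-remQuot; inject≤-injective)
open import Data.Fin.Subset using (Subset; ∣_∣; _⊆_; ⁅_⁆; _∪_) renaming (_∈_ to _∈ₛ_; _∉_ to _∉ₛ_)
open import Data.Fin.Subset.Properties
  using (x∈⁅x⁆; x∈⁅y⁆⇒x≡y; ∣⁅x⁆∣≡1; ⊆-antisym; p⊆q⇒∣p∣≤∣q∣; p⊂q⇒∣p∣<∣q∣; x∈p∪q⁻; x∈p∪q⁺;
         ∪-comm; ∪-assoc; ∪-identityˡ)
  renaming (_∈?_ to _∈ₛ?_)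
open import Data.Product.Base using (Σ-syntax; ∃-syntax; _×_; _,_; proj₁; proj₂)
open import Data.Sum.Base using (_⊎_; inj₁; inj₂)
open import Data.Vec.Base using ([]; _∷_; here; there)
open import Data.Vec.Properties using (≡-dec; ∷-injective)
open import Function.Base using (_∘_)
open import Function.Bundles using (Inverse; mk⇔)
open import Level using (0ℓ)
open import Relation.Binary.Definitions using (DecidableEquality)
open import Relation.Binary.PropositionalEquality
  using (_≡_; _≢_; refl; sym; trans; cong; cong₂; subst; module ≡-Reasoning)
open import Relation.Nullary using (¬_; Dec; yes; no; contradiction)
open import Relation.Nullary.Decidable using (map′; _×-dec_; _⊎-dec_; ¬?)
open import Relation.Unary using (Decidable)

-- Finite sets: counting, enumeration, pairs and triples.

private
  variable
    n : ℕ

-- Without repetitions an element occurs in a list in at most one way, so equality as sets is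
-- equality up to permutation. Both counts in the degree formula rest on this.
unique-sameElements⇒length≡ : {A : Set} {xs ys : List A} → Unique xs → Unique ys →
  (∀ {x} → x ∈ xs → x ∈ ys) → (∀ {x} → x ∈ ys → x ∈ xs) → length xs ≡ length ys
unique-sameElements⇒length≡ xs! ys! xs⊆ys ys⊆xs =
  ↭-length (∼bag⇒↭ (unique∧set⇒bag xs! ys! (mk⇔ xs⊆ys ys⊆xs)))

_≟ₛ_ : DecidableEquality (Subset n)
_≟ₛ_ = ≡-dec Bool._≟_

subsets : ∀ n → List (Subset n)
subsets zero    = [] ∷ []
subsets (suc n) = cartesianProductWith _∷_ (true ∷ false ∷ []) (subsets n)

∈-subsets : (X : Subset n) → X ∈ subsets n
∈-subsets []      = here refl
∈-subsets (b ∷ X) = ∈-cartesianProductWith⁺ _∷_ (∈-bools b) (∈-subsets X)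
  where
  ∈-bools : ∀ b → b ∈ true ∷ false ∷ []
  ∈-bools true  = here refl
  ∈-bools false = there (here refl)

subsets! : ∀ n → Unique (subsets n)
subsets! zero    = [] ∷ []
subsets! (suc n) =
  Unique.cartesianProductWith⁺ _∷_ ∷-injective (((λ ()) ∷ []) ∷ [] ∷ []) (subsets! n)

∣⁅x⁆∪p∣≡1+∣p∣ : ∀ {x} {p : Subset n} → x ∉ₛ p → ∣ ⁅ x ⁆ ∪ p ∣ ≡ suc ∣ p ∣
∣⁅x⁆∪p∣≡1+∣p∣ {x = zero}  {true  ∷ p} x∉p = contradiction here x∉p
∣⁅x⁆∪p∣≡1+∣p∣ {x = zero}  {false ∷ p} x∉p = cong (suc ∘ ∣_∣) (∪-identityˡ p)
∣⁅x⁆∪p∣≡1+∣p∣ {x = suc x} {true  ∷ p} x∉p = cong suc (∣⁅x⁆∪p∣≡1+∣p∣ (x∉p ∘ there))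
∣⁅x⁆∪p∣≡1+∣p∣ {x = suc x} {false ∷ p} x∉p = ∣⁅x⁆∪p∣≡1+∣p∣ (x∉p ∘ there)

⊆∧∣∣≡⇒≡ : {p q : Subset n} → p ⊆ q → ∣ p ∣ ≡ ∣ q ∣ → p ≡ q
⊆∧∣∣≡⇒≡ {p = p} p⊆q eq = ⊆-antisym p⊆q λ {x} x∈q → case-∈ x x∈q (x ∈ₛ? p)
  where
  case-∈ : ∀ x → x ∈ₛ _ → Dec (x ∈ₛ p) → x ∈ₛ p
  case-∈ x x∈q (yes x∈p) = x∈p
  case-∈ x x∈q (no  x∉p) =
    contradiction (p⊂q⇒∣p∣<∣q∣ (p⊆q , x , x∈q , x∉p)) (ℕ.<-irrefl eq)

pair : Fin n → Fin n → Subset n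
pair u v = ⁅ u ⁆ ∪ ⁅ v ⁆

triple : Fin n → Fin n → Fin n → Subset n
triple u v w = ⁅ u ⁆ ∪ pair v w

module _ {u v : Fin n} where

  ∈-pair⁻ : ∀ {x} → x ∈ₛ pair u v → x ≡ u ⊎ x ≡ v
  ∈-pair⁻ x∈ with x∈p∪q⁻ ⁅ u ⁆ ⁅ v ⁆ x∈
  ... | inj₁ x∈u = inj₁ (x∈⁅y⁆⇒x≡y u x∈u)
  ... | inj₂ x∈v = inj₂ (x∈⁅y⁆⇒x≡y v x∈v)

  pair₁ : u ∈ₛ pair u v
  pair₁ = x∈p∪q⁺ (inj₁ (x∈⁅x⁆ u))

  pair₂ : v ∈ₛ pair u v
  pair₂ = x∈p∪q⁺ (inj₂ (x∈⁅x⁆ v))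

  pair-⊆ : ∀ {p} → u ∈ₛ p → v ∈ₛ p → pair u v ⊆ p
  pair-⊆ u∈p v∈p x∈ with ∈-pair⁻ x∈
  ... | inj₁ refl = u∈p
  ... | inj₂ refl = v∈p

  ∣pair∣ : u ≢ v → ∣ pair u v ∣ ≡ 2
  ∣pair∣ u≢v = trans (∣⁅x⁆∪p∣≡1+∣p∣ (u≢v ∘ x∈⁅y⁆⇒x≡y v)) (cong suc (∣⁅x⁆∣≡1 v))

module _ {u v w : Fin n} where

  ∈-triple⁻ : ∀ {x} → x ∈ₛ triple u v w → x ≡ u ⊎ x ≡ v ⊎ x ≡ w
  ∈-triple⁻ x∈ with x∈p∪q⁻ ⁅ u ⁆ (pair v w) x∈
  ... | inj₁ x∈u  = inj₁ (x∈⁅y⁆⇒x≡y u x∈u)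
  ... | inj₂ x∈vw = inj₂ (∈-pair⁻ x∈vw)

  triple₁ : u ∈ₛ triple u v w
  triple₁ = x∈p∪q⁺ (inj₁ (x∈⁅x⁆ u))

  triple₂ : v ∈ₛ triple u v w
  triple₂ = x∈p∪q⁺ (inj₂ pair₁)

  triple₃ : w ∈ₛ triple u v w
  triple₃ = x∈p∪q⁺ {p = ⁅ u ⁆} (inj₂ (pair₂ {u = v}))

  triple-⊆ : ∀ {p} → u ∈ₛ p → v ∈ₛ p → w ∈ₛ p → triple u v w ⊆ p
  triple-⊆ u∈p v∈p w∈p x∈ with ∈-triple⁻ x∈
  ... | inj₁ refl        = u∈p
  ... | inj₂ (inj₁ refl) = v∈p
  ... | inj₂ (inj₂ refl) = w∈p

  triple-rotate : triple v w u ≡ triple u v w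
  triple-rotate = trans (sym (∪-assoc ⁅ v ⁆ ⁅ w ⁆ ⁅ u ⁆)) (∪-comm (pair v w) ⁅ u ⁆)

  ∣triple∣ : u ≢ v → u ≢ w → v ≢ w → ∣ triple u v w ∣ ≡ 3
  ∣triple∣ u≢v u≢w v≢w = trans (∣⁅x⁆∪p∣≡1+∣p∣ u∉) (cong suc (∣pair∣ v≢w))
    where
    u∉ : u ∉ₛ pair v w
    u∉ u∈ with ∈-pair⁻ u∈
    ... | inj₁ u≡v = u≢v u≡v
    ... | inj₂ u≡w = u≢w u≡w

-- Graphs directed cyclically through three colour classes.

rot : Fin 3 → Fin 3
rot zero             = suc zero
rot (suc zero)       = suc (suc zero)
rot (suc (suc zero)) = zero

rot≢ : ∀ c → rot c ≢ c
rot≢ zero             ()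
rot≢ (suc zero)       ()
rot≢ (suc (suc zero)) ()

rot²≢ : ∀ c → rot (rot c) ≢ c
rot²≢ zero             ()
rot²≢ (suc zero)       ()
rot²≢ (suc (suc zero)) ()

rot³ : ∀ c → rot (rot (rot c)) ≡ c
rot³ zero             = refl
rot³ (suc zero)       = refl
rot³ (suc (suc zero)) = refl

-- The edges of G are directed cyclically through the three colour classes,
-- and next i is the directed edge of kind i, so that triangles of G are
-- closed directed walks of length 3.

module TriangleSystem {n s : ℕ}
  (colour : Fin n → Fin 3) (vertex : Fin 3 → Fin n) (next : Fin s → Fin n → Fin n)
  (colour-vertex : ∀ c → colour (vertex c) ≡ c)
  (colour-next   : ∀ i v → colour (next i v) ≡ rot (colour v))
  (next³         : ∀ i v → next i (next i (next i v)) ≡ v)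
  (closed⇒≡      : ∀ i j k v → next k (next j (next i v)) ≡ v → i ≡ j × j ≡ k)
  where

  colour-next² : ∀ i j v → colour (next j (next i v)) ≡ rot (rot (colour v))
  colour-next² i j v = trans (colour-next j _) (cong rot (colour-next i v))

  next≢ : ∀ i v → next i v ≢ v
  next≢ i v eq = rot≢ _ (trans (sym (colour-next i v)) (cong colour eq))

  next²≢ : ∀ i j v → next j (next i v) ≢ v
  next²≢ i j v eq = rot²≢ _ (trans (sym (colour-next² i j v)) (cong colour eq))

  next²≢next : ∀ i j k v → next j (next i v) ≢ next k v
  next²≢next i j k v eq = rot≢ _
    (trans (sym (colour-next² i j v)) (trans (cong colour eq) (colour-next k v)))

  -- If kinds `i` and `j` agree at `v`, the walk `j`, `i`, `i` closes up just as `i`, `i`, `i` does,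
  -- and `closed⇒≡` identifies the kinds.
  next-injective : ∀ {i j v} → next i v ≡ next j v → i ≡ j
  next-injective {i} {j} {v} eq =
    sym (proj₁ (closed⇒≡ j i i v (trans (cong (next i ∘ next i) (sym eq)) (next³ i v))))

  -- By `next³` the square of `next i` is its inverse, so this is the tail of the edge of kind `i`
  -- into `v`.
  prev : Fin s → Fin n → Fin n
  prev i v = next i (next i v)

  prev-injective : ∀ {i j v} → prev i v ≡ prev j v → i ≡ j
  prev-injective {i} {j} {v} eq =
    sym (proj₂ (closed⇒≡ j j i v (trans (cong (next i) (sym eq)) (next³ i v))))

  Next : Fin n → Fin n → Set
  Next u v = ∃[ i ] next i u ≡ v

  next? : ∀ u v → Dec (Next u v)
  next? u v = any? λ i → next i u ≟ v

  next⇒prev : ∀ {i u v} → next i u ≡ v → u ≡ prev i v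
  next⇒prev {i} {u} refl = sym (next³ i u)

  -- The colour of `w` would be both one and two rotations away from that of `u`. Hence every
  -- triangle of G is cyclically oriented.
  ¬transitive : ∀ {u v w} → Next u v → Next v w → ¬ Next u w
  ¬transitive (i , refl) (j , refl) (k , eq) = next²≢next i j k _ (sym eq)

  Adjacent : Fin n → Fin n → Set
  Adjacent u v = Next u v ⊎ Next v u

  adjacent? : ∀ u v → Dec (Adjacent u v)
  adjacent? u v = next? u v ⊎-dec next? v u

  triangle : Fin s → Fin n → Subset n
  triangle i v = triple v (next i v) (prev i v)

  -- Together with `triangle-prev`, this lets a triangle be based at any of its three vertices.
  triangle-next : ∀ i v → triangle i (next i v) ≡ triangle i v
  triangle-next i v = trans (cong (triple _ _) (next³ i v)) triple-rotate

  triangle-prev : ∀ i v → triangle i (prev i v) ≡ triangle i v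
  triangle-prev i v = trans (triangle-next i (next i v)) (triangle-next i v)

  ∣triangle∣ : ∀ i v → ∣ triangle i v ∣ ≡ 3
  ∣triangle∣ i v = ∣triple∣ (next≢ i v ∘ sym) (next²≢ i i v ∘ sym) (next≢ i _ ∘ sym)

  triangle-clique : ∀ i v {x y} → x ∈ₛ triangle i v → y ∈ₛ triangle i v → x ≢ y → Adjacent x y
  triangle-clique i v x∈ y∈ x≢y with ∈-triple⁻ x∈ | ∈-triple⁻ y∈
  ... | inj₁ refl        | inj₁ refl        = contradiction refl x≢y
  ... | inj₁ refl        | inj₂ (inj₁ refl) = inj₁ (i , refl)
  ... | inj₁ refl        | inj₂ (inj₂ refl) = inj₂ (i , next³ i v)
  ... | inj₂ (inj₁ refl) | inj₁ refl        = inj₂ (i , refl)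
  ... | inj₂ (inj₁ refl) | inj₂ (inj₁ refl) = contradiction refl x≢y
  ... | inj₂ (inj₁ refl) | inj₂ (inj₂ refl) = inj₁ (i , refl)
  ... | inj₂ (inj₂ refl) | inj₁ refl        = inj₁ (i , next³ i v)
  ... | inj₂ (inj₂ refl) | inj₂ (inj₁ refl) = inj₂ (i , refl)
  ... | inj₂ (inj₂ refl) | inj₂ (inj₂ refl) = contradiction refl x≢y

  -- The family of non-edges and triangles, and the antichain property.

  data Member : Subset n → Set where
    nonEdge    : ∀ {u v} → u ≢ v → ¬ Adjacent u v → Member (pair u v)
    isTriangle : ∀ i v → Member (triangle i v)

  member? : Decidable Member
  member? X = map′
    (λ { (inj₁ (u , v , u≢v , ¬uv , refl)) → nonEdge u≢v ¬uv
       ; (inj₂ (i , v , refl))             → isTriangle i v })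
    (λ { (nonEdge u≢v ¬uv) → inj₁ (_ , _ , u≢v , ¬uv , refl)
       ; (isTriangle i v)  → inj₂ (i , v , refl) })
    ((any? λ u → any? λ v → ¬? (u ≟ v) ×-dec ¬? (adjacent? u v) ×-dec X ≟ₛ pair u v)
      ⊎-dec any? λ i → any? λ v → X ≟ₛ triangle i v)

  -- A pair has two orders and a triangle three base points, so listing the constructors would
  -- repeat members; filtering the list of all subsets does not.
  𝒜 : List (Subset n)
  𝒜 = filter member? (subsets n)

  𝒜! : Unique 𝒜
  𝒜! = Unique.filter⁺ member? (subsets! n)

  ∈-𝒜⁺ : ∀ {X} → Member X → X ∈ 𝒜
  ∈-𝒜⁺ {X} = ∈-filter⁺ member? (∈-subsets X)

  ∈-𝒜⁻ : ∀ {X} → X ∈ 𝒜 → Member X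
  ∈-𝒜⁻ X∈𝒜 = proj₂ (∈-filter⁻ member? {xs = subsets n} X∈𝒜)

  -- Between members of equal size, cardinality decides; a non-edge does not fit into a clique, nor
  -- a 3-set into a 2-set.
  member-antichain : ∀ {X Y} → Member X → Member Y → X ⊆ Y → X ≡ Y
  member-antichain (nonEdge u≢v _) (nonEdge u′≢v′ _) X⊆Y =
    ⊆∧∣∣≡⇒≡ X⊆Y (trans (∣pair∣ u≢v) (sym (∣pair∣ u′≢v′)))
  member-antichain (nonEdge u≢v ¬uv) (isTriangle i v) X⊆Y =
    contradiction (triangle-clique i v (X⊆Y pair₁) (X⊆Y pair₂) u≢v) ¬uv
  member-antichain (isTriangle i v) (nonEdge u≢v _) X⊆Y
    with p⊆q⇒∣p∣≤∣q∣ X⊆Y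
  ... | 3≤2 rewrite ∣triangle∣ i v | ∣pair∣ u≢v = contradiction 3≤2 λ { (s≤s (s≤s ())) }
  member-antichain (isTriangle i v) (isTriangle j w) X⊆Y =
    ⊆∧∣∣≡⇒≡ X⊆Y (trans (∣triangle∣ i v) (sym (∣triangle∣ j w)))

  -- Maximality.

  Comparable : Subset n → Set
  Comparable X = ∃[ A ] (A ∈ 𝒜 × (X ⊆ A ⊎ A ⊆ X))

  -- A non-edge is itself a member, and an edge of kind `i` lies in a triangle of kind `i`.
  member-⊇ : ∀ {u v X} → u ≢ v → X ⊆ pair u v → Comparable X
  member-⊇ {u} {v} u≢v X⊆uv with adjacent? u v
  ... | no ¬uv = pair u v , ∈-𝒜⁺ (nonEdge u≢v ¬uv) , inj₁ X⊆uv
  ... | yes (inj₁ (i , refl)) =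
    triangle i u , ∈-𝒜⁺ (isTriangle i u) , inj₁ (pair-⊆ triple₁ triple₂ ∘ X⊆uv)
  ... | yes (inj₂ (i , refl)) =
    triangle i v , ∈-𝒜⁺ (isTriangle i v) , inj₁ (pair-⊆ triple₂ triple₁ ∘ X⊆uv)

  -- By `closed⇒≡` the three edges have one kind, so the triangle they form is itself a member.
  cyclic-⊆ : ∀ {u v w X} → u ∈ₛ X → v ∈ₛ X → w ∈ₛ X → Next u v → Next v w → Next w u → Comparable X
  cyclic-⊆ {u} u∈X v∈X w∈X (i , refl) (j , refl) (k , eq)
    with refl , refl ← closed⇒≡ i j k u eq =
    triangle i u , ∈-𝒜⁺ (isTriangle i u) , inj₂ (triple-⊆ u∈X v∈X w∈X)

  -- Of the eight orientations of a triangle two are cyclic; the other six are transitive, hence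
  -- impossible.
  clique-⊆ : ∀ {u v w X} → u ∈ₛ X → v ∈ₛ X → w ∈ₛ X →
             Adjacent u v → Adjacent v w → Adjacent w u → Comparable X
  clique-⊆ u∈ v∈ w∈ (inj₁ uv) (inj₁ vw) (inj₁ wu) = cyclic-⊆ u∈ v∈ w∈ uv vw wu
  clique-⊆ u∈ v∈ w∈ (inj₁ uv) (inj₁ vw) (inj₂ uw) = contradiction uw (¬transitive uv vw)
  clique-⊆ u∈ v∈ w∈ (inj₁ uv) (inj₂ wv) (inj₁ wu) = contradiction wv (¬transitive wu uv)
  clique-⊆ u∈ v∈ w∈ (inj₁ uv) (inj₂ wv) (inj₂ uw) = contradiction uv (¬transitive uw wv)
  clique-⊆ u∈ v∈ w∈ (inj₂ vu) (inj₁ vw) (inj₁ wu) = contradiction vu (¬transitive vw wu)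
  clique-⊆ u∈ v∈ w∈ (inj₂ vu) (inj₁ vw) (inj₂ uw) = contradiction vw (¬transitive vu uw)
  clique-⊆ u∈ v∈ w∈ (inj₂ vu) (inj₂ wv) (inj₁ wu) = contradiction wu (¬transitive wv vu)
  clique-⊆ u∈ v∈ w∈ (inj₂ vu) (inj₂ wv) (inj₂ uw) = cyclic-⊆ u∈ w∈ v∈ uw wv vu

  three-⊆ : ∀ {u v w X} → u ∈ₛ X → v ∈ₛ X → w ∈ₛ X → u ≢ v → v ≢ w → w ≢ u → Comparable X
  three-⊆ {u} {v} {w} u∈ v∈ w∈ u≢v v≢w w≢u
    with adjacent? u v | adjacent? v w | adjacent? w u
  ... | no ¬uv | _      | _      = _ , ∈-𝒜⁺ (nonEdge u≢v ¬uv) , inj₂ (pair-⊆ u∈ v∈)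
  ... | yes _  | no ¬vw | _      = _ , ∈-𝒜⁺ (nonEdge v≢w ¬vw) , inj₂ (pair-⊆ v∈ w∈)
  ... | yes _  | yes _  | no ¬wu = _ , ∈-𝒜⁺ (nonEdge w≢u ¬wu) , inj₂ (pair-⊆ w∈ u∈)
  ... | yes uv | yes vw | yes wu = clique-⊆ u∈ v∈ w∈ uv vw wu

  -- A second vertex, of another colour, with which a set of at most one element is completed to a
  -- pair.
  other : Fin n → Fin n
  other u = vertex (rot (colour u))

  ≢other : ∀ u → u ≢ other u
  ≢other u eq = rot≢ _ (trans (sym (colour-vertex _)) (cong colour (sym eq)))

  -- Up to two elements fit into a pair and so into a member; three distinct elements contain a
  -- non-edge or span a triangle.
  comparable : ∀ X → Comparable X
  comparable X with any? (_∈ₛ? X)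
  ... | no X≡∅ = member-⊇ (≢other (vertex zero)) λ x∈X → contradiction (_ , x∈X) X≡∅
  ... | yes (u , u∈X) with any? (λ v → v ∈ₛ? X ×-dec ¬? (u ≟ v))
  ...   | no X⊆u = member-⊇ (≢other u) X⊆
    where
    X⊆ : X ⊆ pair u (other u)
    X⊆ {x} x∈X with u ≟ x
    ... | yes refl = pair₁
    ... | no  u≢x  = contradiction (x , x∈X , u≢x) X⊆u
  ...   | yes (v , v∈X , u≢v) with any? (λ w → w ∈ₛ? X ×-dec ¬? (v ≟ w) ×-dec ¬? (w ≟ u))
  ...     | yes (w , w∈X , v≢w , w≢u) = three-⊆ u∈X v∈X w∈X u≢v v≢w w≢u
  ...     | no X⊆uv = member-⊇ u≢v X⊆
    where
    X⊆ : X ⊆ pair u v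
    X⊆ {x} x∈X with v ≟ x | x ≟ u
    ... | yes refl | _        = pair₂
    ... | no _     | yes refl = pair₁
    ... | no v≢x   | no x≢u   = contradiction (x , x∈X , v≢x , x≢u) X⊆uv

  isMaximal23Antichain : IsMaximal23Antichain 𝒜
  isMaximal23Antichain = record
    { unique    = 𝒜!
    ; sizes     = λ A∈𝒜 → size (∈-𝒜⁻ A∈𝒜)
    ; antichain = λ A∈𝒜 B∈𝒜 A≢B A⊆B →
        A≢B (member-antichain (∈-𝒜⁻ A∈𝒜) (∈-𝒜⁻ B∈𝒜) A⊆B)
    ; maximal   = λ X _ → comparable X
    }
    where
    size : ∀ {X} → Member X → ∣ X ∣ ≡ 2 ⊎ ∣ X ∣ ≡ 3
    size (nonEdge u≢v _)  = inj₁ (∣pair∣ u≢v)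
    size (isTriangle i v) = inj₂ (∣triangle∣ i v)

  -- The degree of a vertex.

  -- The members containing v correspond to the vertices other than v and its
  -- predecessors: a triangle to the successor of v, a non-edge to its other end.

  module _ (v : Fin n) where

    star : Fin n → Subset n
    star w with next? v w
    ... | yes (i , _) = triangle i v
    ... | no  _       = pair v w

    star-next : ∀ i → star (next i v) ≡ triangle i v
    star-next i with next? v (next i v)
    ... | yes (j , eq) = cong (λ k → triangle k v) (next-injective eq)
    ... | no  ¬next    = contradiction (i , refl) ¬next

    star-nonnext : ∀ {w} → ¬ Next v w → star w ≡ pair v w
    star-nonnext {w} ¬next with next? v w
    ... | yes next = contradiction next ¬next
    ... | no  _    = refl

    -- The set `star w` contains `w`, so `w` lies in `star w′`; its elements other than `w′` are
    -- then ruled out, mostly by colour.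
    star-injective : ∀ {w w′} → star w ≡ star w′ → w ≡ w′
    star-injective {w} {w′} eq with next? v w | next? v w′
    ... | yes (i , refl) | yes (j , refl)
      with ∈-triple⁻ (subst (next i v ∈ₛ_) eq triple₂)
    ...   | inj₁ next≡v          = contradiction next≡v (next≢ i v)
    ...   | inj₂ (inj₁ next≡)    = next≡
    ...   | inj₂ (inj₂ next≡prev) = contradiction (sym next≡prev) (next²≢next j j i v)
    star-injective {w} {w′} eq | yes (i , refl) | no ¬next
      with ∈-pair⁻ (subst (next i v ∈ₛ_) eq triple₂)
    ...   | inj₁ next≡v  = contradiction next≡v (next≢ i v)
    ...   | inj₂ next≡w′ = next≡w′
    star-injective {w} {w′} eq | no ¬next | yes (i , refl)
      with ∈-pair⁻ (subst (next i v ∈ₛ_) (sym eq) triple₂)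
    ...   | inj₁ next≡v = contradiction next≡v (next≢ i v)
    ...   | inj₂ next≡w = sym next≡w
    star-injective {w} {w′} eq | no _ | no _
      with ∈-pair⁻ (subst (w ∈ₛ_) eq (pair₂ {u = v}))
    ...   | inj₂ w≡w′ = w≡w′
    -- Here `w` is `v` and `star w` is the singleton of `v`, so both alternatives give `w′ ≡ v`.
    ...   | inj₁ refl with ∈-pair⁻ (subst (w′ ∈ₛ_) (sym eq) (pair₂ {u = v}))
    ...     | inj₁ w′≡v = sym w′≡v
    ...     | inj₂ w′≡v = sym w′≡v

    Kept : Fin n → Set
    Kept w = w ≢ v × ¬ Next w v

    kept? : Decidable Kept
    kept? w = ¬? (w ≟ v) ×-dec ¬? (next? w v)

    kept excluded : List (Fin n)
    kept     = filter kept? (allFin n)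
    excluded = v ∷ map (λ i → prev i v) (allFin s)

    kept! : Unique kept
    kept! = Unique.filter⁺ kept? (Unique.allFin⁺ n)

    excluded! : Unique excluded
    excluded! = All.tabulate v∉ ∷ Unique.map⁺ prev-injective (Unique.allFin⁺ s)
      where
      v∉ : ∀ {w} → w ∈ map (λ i → prev i v) (allFin s) → v ≢ w
      v∉ w∈ refl with i , _ , eq ← ∈-map⁻ _ w∈ = next²≢ i i v (sym eq)

    disjoint : ∀ {w} → ¬ (w ∈ kept × w ∈ excluded)
    disjoint (w∈kept , w∈excluded)
      with _ , w≢v , ¬next ← ∈-filter⁻ kept? {xs = allFin n} w∈kept | w∈excluded
    ... | here w≡v = w≢v w≡v
    ... | there w∈ with i , _ , refl ← ∈-map⁻ _ w∈ = ¬next (i , next³ i v)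

    covering : ∀ w → w ∈ kept ++ excluded
    covering w with w ≟ v | next? w v
    ... | yes w≡v | _              = ∈-++⁺ʳ kept (here w≡v)
    ... | no _    | yes (i , next≡v) = ∈-++⁺ʳ kept
      (there (subst (_∈ _) (sym (next⇒prev next≡v)) (∈-map⁺ _ (∈-allFin i))))
    ... | no w≢v  | no ¬next       = ∈-++⁺ˡ (∈-filter⁺ kept? (∈-allFin w) (w≢v , ¬next))

    -- The excluded vertices are `v` and its `s` predecessors, which are distinct by
    -- `prev-injective`.
    length-kept : length kept + suc s ≡ n
    length-kept = begin
      length kept + suc s            ≡⟨ cong (length kept +_) length-excluded ⟨
      length kept + length excluded  ≡⟨ length-++ kept ⟨
      length (kept ++ excluded)      ≡⟨ unique-sameElements⇒length≡
                                          (Unique.++⁺ kept! excluded! disjoint) (Unique.allFin⁺ n)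
                                          (λ {w} _ → ∈-allFin w) (λ {w} _ → covering w) ⟩
      length (allFin n)              ≡⟨ length-tabulate {n = n} _ ⟩
      n                              ∎
      where
      open ≡-Reasoning
      length-excluded : length excluded ≡ suc s
      length-excluded = cong suc (trans (length-map _ (allFin s)) (length-tabulate {n = s} _))

    star-kept : ∀ {w} → Kept w → Member (star w) × v ∈ₛ star w
    star-kept {w} (w≢v , ¬wv) with next? v w
    ... | yes (i , _) = isTriangle i v , triple₁
    ... | no ¬vw = nonEdge (w≢v ∘ sym) (λ { (inj₁ vw) → ¬vw vw ; (inj₂ wv) → ¬wv wv }) , pair₁

    star-onto : ∀ {X} → Member X → v ∈ₛ X → ∃[ w ] (Kept w × X ≡ star w)
    star-onto (nonEdge {x} {y} x≢y ¬xy) v∈X with ∈-pair⁻ v∈X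
    ... | inj₁ refl = y , (x≢y ∘ sym , ¬xy ∘ inj₂) , sym (star-nonnext (¬xy ∘ inj₁))
    ... | inj₂ refl = x , (x≢y , ¬xy ∘ inj₁) ,
      trans (∪-comm ⁅ x ⁆ ⁅ y ⁆) (sym (star-nonnext (¬xy ∘ inj₂)))
    -- The triangle is rebased at `v`. Its vertex `next i v` is kept because no closed walk has
    -- length two.
    star-onto (isTriangle i u) v∈X = next i v ,
      (next≢ i v , λ (j , eq) → next²≢ i j v eq) , trans (sym (based (∈-triple⁻ v∈X))) (sym (star-next i))
      where
      based : v ≡ u ⊎ v ≡ next i u ⊎ v ≡ prev i u → triangle i v ≡ triangle i u
      based (inj₁ refl)        = refl
      based (inj₂ (inj₁ refl)) = triangle-next i u
      based (inj₂ (inj₂ refl)) = triangle-prev i u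

    -- `star` maps `kept` bijectively onto the members containing `v`. The additive form of n - 1 -
    -- s avoids truncated subtraction.
    degree-𝒜 : degree 𝒜 v + suc s ≡ n
    degree-𝒜 = trans (cong (_+ suc s) degree≡) length-kept
      where
      star⁺ : ∀ {X} → X ∈ filter (v ∈ₛ?_) 𝒜 → X ∈ map star kept
      star⁺ X∈ with X∈𝒜 , v∈X ← ∈-filter⁻ (v ∈ₛ?_) {xs = 𝒜} X∈
               with w , w-kept , refl ← star-onto (∈-𝒜⁻ X∈𝒜) v∈X =
        ∈-map⁺ star (∈-filter⁺ kept? (∈-allFin w) w-kept)

      star⁻ : ∀ {X} → X ∈ map star kept → X ∈ filter (v ∈ₛ?_) 𝒜
      star⁻ X∈ with w , w∈ , refl ← ∈-map⁻ star X∈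
               with member , v∈ ← star-kept (proj₂ (∈-filter⁻ kept? {xs = allFin n} w∈)) =
        ∈-filter⁺ (v ∈ₛ?_) (∈-𝒜⁺ member) v∈

      degree≡ : degree 𝒜 v ≡ length kept
      degree≡ = trans
        (unique-sameElements⇒length≡ (Unique.filter⁺ (v ∈ₛ?_) 𝒜!)
          (Unique.map⁺ star-injective kept!) star⁺ star⁻)
        (length-map star kept)

-- The tripartite graph of an admissible pair of sequences.

module FromGroup (Γ : AbelianGroup 0ℓ 0ℓ) {m p : ℕ} (ord : HasOrder Γ m)
  {a b : Fin p → AbelianGroup.Carrier Γ} (admissible : IsAdmissible Γ a b)
  {s : ℕ} (s≤p : s ≤ p) where

  open AbelianGroup Γ renaming (refl to ≈-refl; sym to ≈-sym; trans to ≈-trans)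
  open AbelianGroupProperties Γ using (xyx⁻¹≈y)
  open GroupProperties group using (x∙y⁻¹≈ε⇒x≈y; identityʳ-unique)
  open Inverse ord using (to; from; to-cong; from-cong; strictlyInverseˡ; strictlyInverseʳ)
  open IsAdmissible admissible

  -- The translation performed by the directed edge of kind i out of copy x of Γ.
  step : Fin 3 → Fin p → Carrier
  step zero             i = a i
  step (suc zero)       i = c i
  step (suc (suc zero)) i = b i ⁻¹

  -- The total translation of a walk with kinds `i`, `j`, `k` that starts in copy `x`.
  around : Fin 3 → (i j k : Fin p) → Carrier
  around x i j k = (step x i ∙ step (rot x) j) ∙ step (rot (rot x)) k

  -- Since Γ is commutative, the starting point of a closed walk is immaterial, which reduces all
  -- walks to those from copy `zero`.
  around-rotate : ∀ x i j k → around (rot x) i j k ≈ around x k i j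
  around-rotate x i j k = ≈-trans (comm _ _) (≈-trans (≈-sym (assoc _ _ _))
    (∙-congʳ (∙-congʳ (reflexive (cong (λ y → step y k) (rot³ x))))))

  around-ε₀ : ∀ i → around zero i i i ≈ ε
  around-ε₀ i = ≈-trans (∙-congʳ (≈-trans (≈-sym (assoc _ _ _)) (xyx⁻¹≈y (a i) (b i)))) (inverseʳ (b i))

  around-ε : ∀ x i → around x i i i ≈ ε
  around-ε zero i = around-ε₀ i
  around-ε (suc zero) i = ≈-trans (around-rotate zero i i i) (around-ε₀ i)
  around-ε (suc (suc zero)) i = ≈-trans (around-rotate (suc zero) i i i) (around-ε (suc zero) i)

  -- The equation a_i + c_j - b_k = 0 reads b_k - a_i = c_j. Then `c-avoids` forces i = k, after
  -- which c_i = c_j and `c-distinct` forces i = j.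
  around-ε₀⇒≡ : ∀ i j k → around zero i j k ≈ ε → i ≡ j × j ≡ k
  around-ε₀⇒≡ i j k eq = case (i ≟ k) (i ≟ j)
    where
    difference : b k - a i ≈ c j
    difference = ≈-trans (∙-congʳ (≈-sym (x∙y⁻¹≈ε⇒x≈y _ _ eq))) (xyx⁻¹≈y (a i) (c j))

    case : Dec (i ≡ k) → Dec (i ≡ j) → i ≡ j × j ≡ k
    case (no i≢k)   _          = contradiction (j , difference) (c-avoids i k i≢k)
    case (yes refl) (yes refl) = refl , refl
    case (yes refl) (no i≢j)   = contradiction difference (c-distinct i j i≢j)

  around-ε⇒≡ : ∀ x i j k → around x i j k ≈ ε → i ≡ j × j ≡ k
  around-ε⇒≡ zero i j k eq = around-ε₀⇒≡ i j k eq
  around-ε⇒≡ (suc zero) i j k eq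
    with refl , refl ← around-ε₀⇒≡ k i j (≈-trans (≈-sym (around-rotate zero i j k)) eq) = refl , refl
  around-ε⇒≡ (suc (suc zero)) i j k eq
    with refl , refl ← around-ε⇒≡ (suc zero) k i j
                         (≈-trans (≈-sym (around-rotate (suc zero) i j k)) eq) = refl , refl

  at : Fin 3 → Carrier → Fin (3 * m)
  at x g = combine x (to g)

  colour : Fin (3 * m) → Fin 3
  colour v = proj₁ (remQuot {3} m v)

  element : Fin (3 * m) → Carrier
  element v = from (proj₂ (remQuot {3} m v))

  colour-at : ∀ x g → colour (at x g) ≡ x
  colour-at x g = cong proj₁ (remQuot-combine x (to g))

  element-at : ∀ x g → element (at x g) ≈ g
  element-at x g =
    ≈-trans (from-cong (cong proj₂ (remQuot-combine x (to g)))) (strictlyInverseʳ g)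

  at-cong : ∀ {x y g h} → x ≡ y → g ≈ h → at x g ≡ at y h
  at-cong x≡y g≈h = cong₂ combine x≡y (to-cong g≈h)

  at-η : ∀ v → at (colour v) (element v) ≡ v
  at-η v = trans (cong (combine (colour v)) (strictlyInverseˡ _)) (combine-remQuot {3} m v)

  next : Fin p → Fin (3 * m) → Fin (3 * m)
  next i v = at (rot (colour v)) (element v ∙ step (colour v) i)

  next-at : ∀ i x g → next i (at x g) ≡ at (rot x) (g ∙ step x i)
  next-at i x g = at-cong (cong rot (colour-at x g))
    (∙-cong (element-at x g) (reflexive (cong (λ y → step y i) (colour-at x g))))

  colour-next : ∀ i v → colour (next i v) ≡ rot (colour v)
  colour-next i v = colour-at _ _

  next-next-next : ∀ i j k v →
    next k (next j (next i v)) ≡ at (colour v) (element v ∙ around (colour v) i j k)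
  next-next-next i j k v =
    trans (cong (next k) (next-at j (rot (colour v)) _))
      (trans (next-at k (rot (rot (colour v))) _)
        (at-cong (rot³ (colour v)) (≈-trans (∙-congʳ (assoc _ _ _)) (assoc _ _ _))))

  next³ : ∀ i v → next i (next i (next i v)) ≡ v
  next³ i v = trans (next-next-next i i i v)
    (trans (at-cong {colour v} refl (≈-trans (∙-congˡ (around-ε (colour v) i)) (identityʳ _))) (at-η v))

  -- A closed walk fixes the group element of its starting vertex, so its total translation is
  -- neutral.
  closed⇒≡ : ∀ i j k v → next k (next j (next i v)) ≡ v → i ≡ j × j ≡ k
  closed⇒≡ i j k v closed = around-ε⇒≡ (colour v) i j k (identityʳ-unique (element v) _
    (≈-trans (≈-sym (element-at (colour v) _))
      (reflexive (cong element (trans (sym (next-next-next i j k v)) closed)))))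

  -- The conditions on walks pass to any subset of the kinds, so one extremal pair of sequences
  -- serves every `s` up to `p`.
  ι : Fin s → Fin p
  ι i = inject≤ i s≤p

  ι-injective : ∀ {i j} → ι i ≡ ι j → i ≡ j
  ι-injective {i} {j} = inject≤-injective s≤p s≤p i j

  ι-closed⇒≡ : ∀ i j k v → next (ι k) (next (ι j) (next (ι i) v)) ≡ v → i ≡ j × j ≡ k
  ι-closed⇒≡ i j k v closed
    with i≡j , j≡k ← closed⇒≡ (ι i) (ι j) (ι k) v closed = ι-injective i≡j , ι-injective j≡k

  -- The neutral element of Γ serves as representative of each colour class.
  open TriangleSystem colour (λ x → at x ε) (next ∘ ι)
    (λ x → colour-at x ε) (colour-next ∘ ι) (next³ ∘ ι)
    ι-closed⇒≡
    public using (𝒜; isMaximal23Antichain; degree-𝒜)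

-- Choice of the number of kinds for a given degree.

theorem6 : (n′ : ℕ) → .{{_ : NonZero n′}} →
    let n = 3 * n′ in
    (r : ℕ) → n ∸ 1 ∸ p-max n′ ≤ r → r ≤ n ∸ 1 →
    Σ[ 𝒜 ∈ List (Subset n) ] (IsMaximal23Antichain 𝒜 × IsRegular r 𝒜)
theorem6 n′ r n-1-p≤r r≤n-1
  with Γ , ord , a , b , admissible ← IsPMax.attained (p-max-isPMax n′) =
  𝒜 , isMaximal23Antichain , λ v → +-cancelʳ-≡ (suc s) (degree 𝒜 v) r (trans (degree-𝒜 v) (sym r+1+s≡n))
  where
  -- Solves r = n - 1 - s. The lower bound on `r` gives `s≤p`; the upper bound prevents truncation.
  s = 3 * n′ ∸ 1 ∸ r

  s≤p : s ≤ p-max n′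
  s≤p = m≤n+o⇒m∸n≤o (3 * n′ ∸ 1) r
    (subst (3 * n′ ∸ 1 ≤_) (ℕ.+-comm (p-max n′) r)
      (ℕ.≤-trans (m≤n+m∸n (3 * n′ ∸ 1) (p-max n′)) (+-monoʳ-≤ (p-max n′) n-1-p≤r)))

  r+1+s≡n : r + suc s ≡ 3 * n′
  r+1+s≡n = begin
    r + suc s         ≡⟨ ℕ.+-suc r s ⟩
    suc (r + s)       ≡⟨ cong suc (m+[n∸m]≡n r≤n-1) ⟩
    -- Positivity of `n′` makes this subtraction exact.
    suc (3 * n′ ∸ 1)  ≡⟨ m+[n∸m]≡n (>-nonZero⁻¹ (3 * n′) {{m*n≢0 3 n′}}) ⟩
    3 * n′            ∎
    where open ≡-Reasoning

  open FromGroup Γ ord admissible s≤p
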